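{- Let $k$ and $\ell$ be two integers such that $k,\ell>1$. If $k$ and $\ell$ have the same parity, then the rectangular grid graph $G_{k,\ell}$ is balanceable.
   Context: All graphs are simple and finite. $G_{k,\ell}$ is the rectangular grid graph with $k$ vertices per row and $\ell$ vertices per column, i.e. the Cartesian product of a path on $k$ vertices and a path on $\ell$ vertices. A 2-coloring of the edges of $K_n$ is a function $\alpha:E(K_n)\to\{R,B\}$. It contains a balanced copy of a graph $G$ if $K_n$ has a (not necessarily induced) subgraph isomorphic to $G$ whose edge set is partitioned into $E_1,E_2$ with $\alpha(e)=R$ for $e\in E_1$, $\alpha(e)=B$ for $e\in E_2$, and $\big||E_1|-|E_2|\big|\le 1$. A graph $G$ is balanceable if there is an $n_0$ such that for every $n\ge n_0$ there exists an integer $m$ with $0\le m<\lfloor \frac12\binom n2\rfloor$ such that every 2-coloring $\alpha$ of $E(K_n)$ with $|\alpha^{ -1}(R)|>m$ and $|\alpha^{ -1}(B)|>m$ contains a balanced copy of $G$. -}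

module Defs where

open import Data.Fin using (Fin; toℕ; _<?_)
open import Data.Fin.Properties using (_≟_)
open import Data.Fin.Subset using (Subset; _∈_)
open import Data.List using (List; allFin; cartesianProduct; filter; length)
open import Data.Nat using (ℕ; suc; _≤_; _<_; _>_; _≥_; _/_; ∣_-_∣)
open import Data.Nat.Combinatorics using (_C_)
open import Data.Nat.Properties using (1+n≢n)
open import Data.Product using (Σ; ∃; ∃-syntax; _×_; _,_)
open import Data.Sum using (_⊎_; inj₁; inj₂; swap)
open import Function using (_∘_; _↔_; _⇔_; Inverse)
open import Level using (0ℓ)
open import Relation.Binary using (Rel; Decidable; DecidableEquality; Symmetric)
open import Relation.Binary.PropositionalEquality using (_≡_; _≢_; refl; sym)
open import Relation.Nullary using (¬_; yes; no; ¬?)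
open import Relation.Nullary.Decidable using (_×-dec_)

-- Finiteness is a matter of the vertex type: it is not a field, but every
-- vertex type used below is finite.
record Graph (V : Set) : Set₁ where
  field
    Adj    : Rel V 0ℓ
    symm   : Symmetric Adj
    noLoop : ∀ {v} → ¬ Adj v v

open Graph

record _≅_ {V W : Set} (G : Graph V) (H : Graph W) : Set where
  field
    vertices : V ↔ W
    adjacent : ∀ u v →
      Adj G u v ⇔ Adj H (Inverse.to vertices u) (Inverse.to vertices v)

complete : ∀ n → Graph (Fin n)
complete n = record
  { Adj    = _≢_
  ; symm   = λ u≢v → u≢v ∘ sym
  ; noLoop = λ v≢v → v≢v refl
  }

path : ∀ n → Graph (Fin n)
path n = record
  { Adj    = λ i j → (suc (toℕ i) ≡ toℕ j) ⊎ (suc (toℕ j) ≡ toℕ i)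
  ; symm   = swap
  ; noLoop = λ { (inj₁ p) → 1+n≢n p ; (inj₂ p) → 1+n≢n p }
  }

_□_ : ∀ {V W} → Graph V → Graph W → Graph (V × W)
G □ H = record
  { Adj    = λ (u , x) (v , y) → (u ≡ v × Adj H x y) ⊎ (x ≡ y × Adj G u v)
  ; symm   = λ { (inj₁ (p , a)) → inj₁ (sym p , symm H a)
               ; (inj₂ (p , a)) → inj₂ (sym p , symm G a) }
  ; noLoop = λ { (inj₁ (_ , a)) → noLoop H a ; (inj₂ (_ , a)) → noLoop G a }
  }

grid : ∀ k ℓ → Graph (Fin k × Fin ℓ)
grid k ℓ = path k □ path ℓ

-- Not necessarily induced. Adjacency is decidable so that edges can be counted.
record Subgraph {n : ℕ} (G : Graph (Fin n)) : Set₁ where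
  field
    verts : Subset n
    SAdj  : Rel (Fin n) 0ℓ
    sadj? : Decidable SAdj
    ssymm : Symmetric SAdj
    sub   : ∀ {u v} → SAdj u v → Adj G u v
    ends  : ∀ {u v} → SAdj u v → u ∈ verts

  graph : Graph (∃ (_∈ verts))
  graph = record
    { Adj    = λ (u , _) (v , _) → SAdj u v
    ; symm   = ssymm
    ; noLoop = noLoop G ∘ sub
    }

-- Each edge is listed once, with its smaller endpoint first.
edges : ∀ {n} {R : Rel (Fin n) 0ℓ} → Decidable R → List (Fin n × Fin n)
edges {n} R? =
  filter (λ (u , v) → (u <? v) ×-dec R? u v) (cartesianProduct (allFin n) (allFin n))

completeEdges : ∀ n → List (Fin n × Fin n)
completeEdges n = edges (λ (u v : Fin n) → ¬? (u ≟ v))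

data Colour : Set where
  red blue : Colour

_≟ᶜ_ : DecidableEquality Colour
red  ≟ᶜ red  = yes refl
red  ≟ᶜ blue = no λ ()
blue ≟ᶜ red  = no λ ()
blue ≟ᶜ blue = yes refl

-- A function on unordered pairs is a symmetric function on ordered pairs;
-- its values on the diagonal, which is not part of E(Kₙ), are never used.
record Colouring (n : ℕ) : Set where
  field
    colour   : Fin n → Fin n → Colour
    colour-≡ : ∀ u v → colour u v ≡ colour v u

open Colouring

count : ∀ {n} → Colouring n → Colour → List (Fin n × Fin n) → ℕ
count α c es = length (filter (λ (u , v) → colour α u v ≟ᶜ c) es)

-- The parts E₁ and E₂ are necessarily the red and the blue edges of the copy.
ContainsBalanced : ∀ {n V} → Colouring n → Graph V → Set₁
ContainsBalanced {n} α G =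
  Σ (Subgraph (complete n)) λ H → let es = edges (Subgraph.sadj? H) in
    Subgraph.graph H ≅ G × ∣ count α red es - count α blue es ∣ ≤ 1

Balanceable : ∀ {V} → Graph V → Set₁
Balanceable G =
  ∃[ n₀ ] ∀ n → n ≥ n₀ →
    ∃[ m ] m < (n C 2) / 2 ×
      (∀ (α : Colouring n) →
        count α red (completeEdges n) > m →
        count α blue (completeEdges n) > m →
        ContainsBalanced α G)

{-# OPTIONS --safe #-}
module Submission where

-- In a large complete graph whose colouring has about as many red as blue edges,
-- there are a clique X of one colour c and a set Y, both as large as the grid, such
-- that all edges between X and Y have the other colour c′ (edges inside Y may have
-- any colour).  Indeed many vertices have c′-degree at least n/8; by Ramsey's theorem
-- they contain a large c-clique, which by double counting has many vertices rich in
-- c′-neighbours inside it and thus yields X and Y, or else a large c′-clique.  Doing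
-- this for both colours, one may assume cliques of both colours, and the pigeonhole
-- principle between these two yields X and Y again.
--
-- Put an independent set I of the grid into Y and the other vertices into X: the edges
-- of colour c′ are those meeting I.  The half-turn of the grid preserves the classes of
-- its bipartition because k and ℓ have the same parity, and it has no fixed point in one
-- of them.  Let I consist of one vertex of each orbit in that class.  Every edge has
-- exactly one end in the class, so the half-turn exchanges the two colours.

open import Defs
open import Data.Empty using (⊥-elim)
open import Data.Fin using (Fin; toℕ; opposite; combine; inject≤)
import Data.Fin as Fin
import Data.Fin.Properties as Fin
import Data.Fin.Subset as Subset
open import Data.List using (List; []; _∷_; _++_; length; map; filter; allFin; cartesianProduct; lookup)
open import Data.List.Properties using (length-map; length-++; length-tabulate; length-filter; filter-++)
open import Data.List.Membership.Propositional using (_∈_)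
open import Data.List.Membership.Propositional.Properties
open import Data.List.Membership.Propositional.Properties.WithK using (unique∧set⇒bag)
import Data.List.Membership.DecPropositional as DecMembership
open import Data.List.Relation.Binary.BagAndSetEquality using (∼bag⇒↭)
open import Data.List.Relation.Binary.Permutation.Propositional.Properties using (↭-length)
open import Data.List.Relation.Binary.Sublist.Propositional
  using (_⊆_; []; _∷_; _∷ʳ_; ⊆-refl; ⊆-trans; minimum)
open import Data.List.Relation.Binary.Sublist.Propositional.Properties using (All-resp-⊆)
open import Data.List.Relation.Unary.All as All using (All; []; _∷_)
open import Data.List.Relation.Unary.AllPairs as AllPairs using (AllPairs; []; _∷_)
open import Data.List.Relation.Unary.Unique.Propositional using (Unique)
import Data.List.Relation.Unary.Unique.Propositional.Properties as Unique
open import Data.Nat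
open import Data.Nat.Combinatorics using (_C_; nC1≡n; nCk+nC[k+1]≡[n+1]C[k+1])
open import Data.Nat.DivMod using (m≡m%n+[m/n]*n; m%n<n)
open import Data.Nat.ListAction using (sum)
open import Data.Nat.Properties
open import Data.Nat.Tactic.RingSolver using (solve-∀)
open import Data.Parity using (Parity; 0ℙ; 1ℙ; _⁻¹)
import Data.Parity as ℙ
import Data.Parity.Properties as ℙ
open import Data.Product using (∃; ∃-syntax; _×_; _,_; proj₁; proj₂; swap; uncurry)
open import Data.Product.Properties using (≡-dec; Σ-≡,≡→≡)
open import Data.Sum as Sum using (_⊎_; inj₁; inj₂)
open import Data.Vec using (tabulate)
open import Data.Vec.Properties using (lookup⇒[]=; []=⇒lookup; lookup∘tabulate)
open import Data.Vec.Properties.WithK using ([]=-irrelevant)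
open import Function using (_∘_; _⇔_; mk⇔; mk↔ₛ′; Equivalence)
open import Level using (0ℓ)
open import Relation.Binary using (Rel; Decidable; Symmetric; tri<; tri≈; tri>)
open import Relation.Binary.PropositionalEquality
open import Relation.Nullary using (¬_; yes; no; ¬?; Dec; does)
open import Relation.Nullary.Decidable using (_×-dec_; dec-true; _⊎-dec_)
open import Relation.Unary using (Pred)

open Colouring
open Graph

private variable
  A B : Set

-- Pigeonhole principle and Ramsey's theorem for lists

AllPairs-resp-⊆ : {R : Rel A 0ℓ} {xs ys : List A} → ys ⊆ xs → AllPairs R xs → AllPairs R ys
AllPairs-resp-⊆ []             []         = []
AllPairs-resp-⊆ (x ∷ʳ ys⊆xs)   (_  ∷ pxs) = AllPairs-resp-⊆ ys⊆xs pxs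
AllPairs-resp-⊆ (refl ∷ ys⊆xs) (px ∷ pxs) = All-resp-⊆ ys⊆xs px ∷ AllPairs-resp-⊆ ys⊆xs pxs

Among : Pred A 0ℓ → ℕ → List A → Set
Among P m xs = ∃[ ys ] ys ⊆ xs × length ys ≡ m × All P ys

among-[] : {P : Pred A 0ℓ} {xs : List A} → Among P 0 xs
among-[] = [] , minimum _ , refl , []

among-there : {P : Pred A 0ℓ} {m : ℕ} {x : A} {xs : List A} → Among P m xs → Among P m (x ∷ xs)
among-there (ys , ys⊆xs , eq , pys) = ys , _ ∷ʳ ys⊆xs , eq , pys

among-here : {P : Pred A 0ℓ} {m : ℕ} {x : A} {xs : List A} → P x → Among P m xs → Among P (suc m) (x ∷ xs)
among-here px (ys , ys⊆xs , eq , pys) = _ ∷ ys , refl ∷ ys⊆xs , cong suc eq , px ∷ pys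

pigeonhole : {P Q : Pred A 0ℓ} (m k : ℕ) (xs : List A) → m + k ≤ length xs →
             All (λ x → P x ⊎ Q x) xs → Among P m xs ⊎ Among Q k xs
pigeonhole zero    k       xs       _         _                = inj₁ among-[]
pigeonhole (suc m) zero    xs       _         _                = inj₂ among-[]
pigeonhole (suc m) (suc k) (x ∷ xs) (s≤s le)  (inj₁ px ∷ pqxs) =
  Sum.map (among-here px) among-there (pigeonhole m (suc k) xs le pqxs)
pigeonhole (suc m) (suc k) (x ∷ xs) (s≤s le)  (inj₂ qx ∷ pqxs) =
  Sum.map among-there (among-here qx)
    (pigeonhole (suc m) k xs (≤-trans (≤-reflexive (sym (+-suc m k))) le) pqxs)

Clique : Rel A 0ℓ → ℕ → List A → Set
Clique R m xs = ∃[ ys ] ys ⊆ xs × length ys ≡ m × AllPairs R ys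

clique-⊆ : {R : Rel A 0ℓ} {m : ℕ} {xs ys : List A} → xs ⊆ ys → Clique R m xs → Clique R m ys
clique-⊆ xs⊆ys (zs , zs⊆xs , eq , pzs) = zs , ⊆-trans zs⊆xs xs⊆ys , eq , pzs

clique-∷ : {R : Rel A 0ℓ} {m : ℕ} {x : A} {xs ys : List A} → ys ⊆ xs → All (R x) ys →
           Clique R m ys → Clique R (suc m) (x ∷ xs)
clique-∷ ys⊆xs rys (zs , zs⊆ys , eq , pzs) =
  _ ∷ zs , refl ∷ ⊆-trans zs⊆ys ys⊆xs , cong suc eq , All-resp-⊆ zs⊆ys rys ∷ pzs

-- The Erdős-Szekeres recursion; the `suc` pays for the vertex whose neighbours are split by colour.
ramseyBound : ℕ → ℕ → ℕ
ramseyBound zero    b       = 0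
ramseyBound (suc a) zero    = 0
ramseyBound (suc a) (suc b) = suc (ramseyBound a (suc b) + ramseyBound (suc a) b)

ramsey : {R S : Rel A 0ℓ} (a b : ℕ) (xs : List A) → ramseyBound a b ≤ length xs →
         AllPairs (λ x y → R x y ⊎ S x y) xs → Clique R a xs ⊎ Clique S b xs
ramsey zero    b       xs       _        _ = inj₁ ([] , minimum _ , refl , [])
ramsey (suc a) zero    xs       _        _ = inj₂ ([] , minimum _ , refl , [])
ramsey (suc a) (suc b) (x ∷ xs) (s≤s le) (rsx ∷ rs)
  with pigeonhole (ramseyBound a (suc b)) (ramseyBound (suc a) b) xs le rsx
... | inj₁ (ys , ys⊆xs , eq , rys) =
  Sum.map (clique-∷ ys⊆xs rys) (clique-⊆ (x ∷ʳ ys⊆xs))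
    (ramsey a (suc b) ys (≤-reflexive (sym eq)) (AllPairs-resp-⊆ ys⊆xs rs))
... | inj₂ (ys , ys⊆xs , eq , sys) =
  Sum.map (clique-⊆ (x ∷ʳ ys⊆xs)) (clique-∷ ys⊆xs sys)
    (ramsey (suc a) b ys (≤-reflexive (sym eq)) (AllPairs-resp-⊆ ys⊆xs rs))

-- Averaging, bicliques and double counting

length-allFin : ∀ n → length (allFin n) ≡ n
length-allFin n = length-tabulate {n = n} (λ i → i)

+-exchange : ∀ x y z → x + (y + z) ≡ y + (x + z)
+-exchange = solve-∀

sumOver : (A → ℕ) → List A → ℕ
sumOver f xs = sum (map f xs)

-- If fewer than `m` entries reached `t`, these would contribute at most `m * b` and the others at
-- most `t` each.
averaging : (f : A → ℕ) (b t m : ℕ) (xs : List A) → (∀ x → f x ≤ b) →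
            m * b + length xs * t < sumOver f xs → Among (λ x → t ≤ f x) m xs
averaging f b t zero    xs       f≤b lt = among-[]
averaging f b t (suc m) (x ∷ xs) f≤b lt with t ≤? f x
... | yes t≤fx = among-here t≤fx (averaging f b t m xs f≤b
      (+-cancelˡ-< (f x) _ _ (≤-<-trans (begin
        f x + (m * b + length xs * t)       ≤⟨ +-monoˡ-≤ _ (f≤b x) ⟩
        b + (m * b + length xs * t)         ≡⟨ +-assoc b (m * b) _ ⟨
        suc m * b + length xs * t           ≤⟨ +-monoʳ-≤ (suc m * b) (m≤n+m _ t) ⟩
        suc m * b + suc (length xs) * t     ∎) lt)))
  where open ≤-Reasoning
... | no t≰fx = among-there (averaging f b t (suc m) xs f≤b
      (+-cancelˡ-< (f x) _ _ (≤-<-trans (begin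
        f x + (suc m * b + length xs * t)   ≤⟨ +-monoˡ-≤ _ (<⇒≤ (≰⇒> t≰fx)) ⟩
        t + (suc m * b + length xs * t)     ≡⟨ +-exchange t (suc m * b) (length xs * t) ⟩
        suc m * b + suc (length xs) * t     ∎) lt)))
  where open ≤-Reasoning

degreeIn : {R : A → B → Set} → (∀ x y → Dec (R x y)) → List B → A → ℕ
degreeIn R? ys x = length (filter (R? x) ys)

-- A list of length `l` allows `2 ^ l` neighbourhoods, so among this many vertices some `m` have the
-- same one.
bicliqueBound : ℕ → ℕ → ℕ
bicliqueBound m l = m * 2 ^ l

-- The pigeonhole on neighbourhoods, one `y` at a time: half of `xs` is joined to `y` and needs one
-- neighbour fewer from the rest, or half of `xs` finds all `t` neighbours in the rest.
biclique : {R : A → B → Set} (R? : ∀ x y → Dec (R x y))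
           (a t : ℕ) (ys : List B) (xs : List A) → bicliqueBound (suc a) (length ys) ≤ length xs →
           All (λ x → t ≤ degreeIn R? ys x) xs →
           ∃[ xs′ ] ∃[ ys′ ] xs′ ⊆ xs × ys′ ⊆ ys × suc a ≤ length xs′ × t ≤ length ys′ ×
             All (λ x → All (R x) ys′) xs′
-- A positive size `suc a` makes `xs` nonempty, and its first member shows that `t` is 0.
biclique R? a t [] xs@(_ ∷ _) le (t≤0 ∷ _) =
  xs , [] , ⊆-refl , [] , ≤-trans (≤-reflexive (sym (*-identityʳ (suc a)))) le , t≤0 ,
    All.universal (λ _ → []) xs
biclique {R = R} R? a t (y ∷ ys) xs le degs
  with pigeonhole {P = λ x → R x y × pred t ≤ degreeIn R? ys x} {Q = λ x → t ≤ degreeIn R? ys x}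
         (bicliqueBound (suc a) (length ys)) (bicliqueBound (suc a) (length ys)) xs
         (≤-trans (≤-reflexive (eq (suc a) (2 ^ length ys))) le) (All.map step degs)
  where
  eq : ∀ m k → m * k + m * k ≡ m * (2 * k)
  eq = solve-∀
  step : ∀ {x} → t ≤ degreeIn R? (y ∷ ys) x →
         (R x y × pred t ≤ degreeIn R? ys x) ⊎ t ≤ degreeIn R? ys x
  step {x} t≤d with R? x y
  ... | yes rxy = inj₁ (rxy , pred-mono-≤ t≤d)
  ... | no _    = inj₂ t≤d
... | inj₁ (zs , zs⊆xs , len , pzs)
  with xs′ , ys′ , xs′⊆zs , ys′⊆ys , a≤ , t≤ , r ←
    biclique R? a (pred t) ys zs (≤-reflexive (sym len)) (All.map proj₂ pzs) =
  xs′ , y ∷ ys′ , ⊆-trans xs′⊆zs zs⊆xs , refl ∷ ys′⊆ys , a≤ , pred≤⇒≤suc t t≤ ,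
    All.zipWith (λ ((rxy , _) , rx) → rxy ∷ rx) (All-resp-⊆ xs′⊆zs pzs , r)
  where
  pred≤⇒≤suc : ∀ t {m} → pred t ≤ m → t ≤ suc m
  pred≤⇒≤suc zero    _  = z≤n
  pred≤⇒≤suc (suc t) le = s≤s le
... | inj₂ (zs , zs⊆xs , len , pzs)
  with xs′ , ys′ , xs′⊆zs , ys′⊆ys , a≤ , t≤ , r ←
    biclique R? a t ys zs (≤-reflexive (sym len)) pzs =
  xs′ , ys′ , ⊆-trans xs′⊆zs zs⊆xs , y ∷ʳ ys′⊆ys , a≤ , t≤ , r

degreeIn-∷ : {R : A → B → Set} (R? : ∀ x y → Dec (R x y)) (y : B) (ys : List B) (xs : List A) →
  sumOver (degreeIn R? (y ∷ ys)) xs ≡ degreeIn (λ y x → R? x y) xs y + sumOver (degreeIn R? ys) xs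
degreeIn-∷ R? y ys []       = refl
degreeIn-∷ R? y ys (x ∷ xs) with R? x y | degreeIn-∷ R? y ys xs
... | no  _ | eq = trans (cong (degreeIn R? ys x +_) eq)
  (+-exchange (degreeIn R? ys x) (degreeIn (λ y x → R? x y) xs y) _)
... | yes _ | eq = cong suc (trans (cong (degreeIn R? ys x +_) eq)
  (+-exchange (degreeIn R? ys x) (degreeIn (λ y x → R? x y) xs y) _))

doubleCounting : {R : A → B → Set} (R? : ∀ x y → Dec (R x y)) (xs : List A) (ys : List B) →
  sumOver (degreeIn R? ys) xs ≡ sumOver (degreeIn (λ y x → R? x y) xs) ys
doubleCounting R? xs []       = zeros xs
  where
  zeros : ∀ xs → sumOver (degreeIn R? []) xs ≡ 0
  zeros []       = refl
  zeros (_ ∷ xs) = zeros xs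
doubleCounting R? xs (y ∷ ys) =
  trans (degreeIn-∷ R? y ys xs) (cong (degreeIn (λ y x → R? x y) xs y +_) (doubleCounting R? xs ys))

length-filter-cartesianProduct : {R : A → B → Set} (R? : ∀ x y → Dec (R x y)) (xs : List A) (ys : List B) →
  length (filter (λ (x , y) → R? x y) (cartesianProduct xs ys)) ≡ sumOver (degreeIn R? ys) xs
length-filter-cartesianProduct R? []       ys = refl
length-filter-cartesianProduct {R = R} R? (x ∷ xs) ys = begin
  length (filter P? (map (x ,_) ys ++ cartesianProduct xs ys))
    ≡⟨ cong length (filter-++ P? (map (x ,_) ys) _) ⟩
  length (filter P? (map (x ,_) ys) ++ filter P? (cartesianProduct xs ys))
    ≡⟨ length-++ (filter P? (map (x ,_) ys)) ⟩
  length (filter P? (map (x ,_) ys)) + length (filter P? (cartesianProduct xs ys))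
    ≡⟨ cong₂ _+_ (row ys) (length-filter-cartesianProduct R? xs ys) ⟩
  degreeIn R? ys x + sumOver (degreeIn R? ys) xs ∎
  where
  open ≡-Reasoning
  P? : ∀ p → Dec (R (proj₁ p) (proj₂ p))
  P? (x , y) = R? x y
  row : ∀ ys → length (filter P? (map (x ,_) ys)) ≡ degreeIn R? ys x
  row []       = refl
  row (y ∷ ys) with R? x y
  ... | yes _ = cong suc (row ys)
  ... | no  _ = row ys

-- Counting edges through ordered pairs

unique-length : {xs ys : List A} → Unique xs → Unique ys → (∀ {z} → z ∈ xs ⇔ z ∈ ys) → length xs ≡ length ys
unique-length xs! ys! xs∼ys = ↭-length (∼bag⇒↭ (unique∧set⇒bag xs! ys! xs∼ys))

edges! : ∀ {n} {R : Rel (Fin n) 0ℓ} (R? : Decidable R) → Unique (edges R?)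
edges! {n} R? = Unique.filter⁺ _ (Unique.cartesianProduct⁺ (Unique.allFin⁺ n) (Unique.allFin⁺ n))

-- `edges` lists each edge with its smaller end first, so the edges of colour `c` and their swapped
-- copies are disjoint and together exhaust `ps`. It serves both for the complete graph and for the
-- copy of the grid.
handshake : ∀ {n} {R : Rel (Fin n) 0ℓ} (R? : Decidable R) (α : Colouring n) (c : Colour) →
  Symmetric R → (∀ {v} → ¬ R v v) → (ps : List (Fin n × Fin n)) → Unique ps →
  (∀ {u v} → (u , v) ∈ ps ⇔ (R u v × colour α u v ≡ c)) →
  length ps ≡ count α c (edges R?) + count α c (edges R?)
handshake {n} {R} R? α c symm irr ps ps! ps⇔ = begin
  length ps                        ≡⟨ unique-length ps! both! (mk⇔ to from) ⟩
  length (cs ++ map swap cs)       ≡⟨ length-++ cs ⟩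
  length cs + length (map swap cs) ≡⟨ cong (length cs +_) (length-map swap cs) ⟩
  length cs + length cs            ∎
  where
  open ≡-Reasoning
  cs = filter (λ (u , v) → colour α u v ≟ᶜ c) (edges R?)

  ∈cs⁻ : ∀ {u v} → (u , v) ∈ cs → u Fin.< v × R u v × colour α u v ≡ c
  ∈cs⁻ uv∈ with uv∈es , col ← ∈-filter⁻ _ {xs = edges R?} uv∈
           with _ , u<v , r ← ∈-filter⁻ _ {xs = cartesianProduct (allFin n) (allFin n)} uv∈es = u<v , r , col

  ∈cs⁺ : ∀ {u v} → u Fin.< v → R u v → colour α u v ≡ c → (u , v) ∈ cs
  ∈cs⁺ u<v r col = ∈-filter⁺ _ (∈-filter⁺ _ (∈-cartesianProduct⁺ (∈-allFin _) (∈-allFin _)) (u<v , r)) col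

  cs! : Unique cs
  cs! = Unique.filter⁺ _ (edges! R?)

  both! : Unique (cs ++ map swap cs)
  both! = Unique.++⁺ cs! (Unique.map⁺ (λ { refl → refl }) cs!) disjoint
    where
    disjoint : ∀ {p} → ¬ (p ∈ cs × p ∈ map swap cs)
    disjoint (p∈ , p∈′) with _ , q∈ , refl ← ∈-map⁻ swap p∈′ =
      Fin.<-asym (proj₁ (∈cs⁻ p∈)) (proj₁ (∈cs⁻ q∈))

  to′ : ∀ {u v} → R u v → colour α u v ≡ c → (u , v) ∈ cs ++ map swap cs
  to′ {u} {v} r col with Fin.<-cmp u v
  ... | tri< u<v _ _ = ∈-++⁺ˡ (∈cs⁺ u<v r col)
  ... | tri≈ _ refl _ = ⊥-elim (irr r)
  ... | tri> _ _ v<u = ∈-++⁺ʳ cs (∈-map⁺ swap (∈cs⁺ v<u (symm r) (trans (colour-≡ α v u) col)))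

  to : ∀ {p} → p ∈ ps → p ∈ cs ++ map swap cs
  to {u , v} p∈ = let r , col = Equivalence.to ps⇔ p∈ in to′ r col

  from : ∀ {p} → p ∈ cs ++ map swap cs → p ∈ ps
  from {u , v} p∈ with ∈-++⁻ cs p∈
  ... | inj₁ p∈cs = let _ , r , col = ∈cs⁻ p∈cs in Equivalence.from ps⇔ (r , col)
  ... | inj₂ p∈sw with (a , b) , q∈ , refl ← ∈-map⁻ swap p∈sw =
    let _ , r , col = ∈cs⁻ q∈ in Equivalence.from ps⇔ (symm r , trans (colour-≡ α b a) col)

-- Half of the edges, and numerical thresholds

n²≡2*nC2+n : ∀ n → n * n ≡ 2 * (n C 2) + n
n²≡2*nC2+n zero    = refl
n²≡2*nC2+n (suc n) = begin
  suc n * suc n                  ≡⟨ e₁ n ⟩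
  n * n + (1 + 2 * n)            ≡⟨ cong (_+ (1 + 2 * n)) (n²≡2*nC2+n n) ⟩
  2 * (n C 2) + n + (1 + 2 * n)  ≡⟨ e₂ n (n C 2) ⟩
  2 * (n + n C 2) + suc n        ≡⟨ cong (λ m → 2 * (m + n C 2) + suc n) (nC1≡n n) ⟨
  2 * (n C 1 + n C 2) + suc n    ≡⟨ cong (λ m → 2 * m + suc n) (nCk+nC[k+1]≡[n+1]C[k+1] n 1) ⟩
  2 * (suc n C 2) + suc n        ∎
  where
  open ≡-Reasoning
  e₁ : ∀ n → suc n * suc n ≡ n * n + (1 + 2 * n)
  e₁ = solve-∀
  e₂ : ∀ n k → 2 * k + n + (1 + 2 * n) ≡ 2 * (n + k) + suc n
  e₂ = solve-∀

n²≤4*half+n+2 : ∀ n → n * n ≤ 4 * ((n C 2) / 2) + n + 2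
n²≤4*half+n+2 n = begin
  n * n                       ≡⟨ n²≡2*nC2+n n ⟩
  2 * k + n                   ≡⟨ cong (λ m → 2 * m + n) (m≡m%n+[m/n]*n k 2) ⟩
  2 * (k % 2 + k / 2 * 2) + n ≤⟨ +-monoˡ-≤ n (*-monoʳ-≤ 2 (+-monoˡ-≤ _ (s≤s⁻¹ (m%n<n k 2)))) ⟩
  2 * (1 + k / 2 * 2) + n     ≡⟨ eq (k / 2) n ⟩
  4 * (k / 2) + n + 2         ∎
  where
  open ≤-Reasoning
  k = n C 2
  eq : ∀ h n → 2 * (1 + h * 2) + n ≡ 4 * h + n + 2
  eq = solve-∀

sumOver-* : (k : ℕ) (f : A → ℕ) (xs : List A) → sumOver (λ x → k * f x) xs ≡ k * sumOver f xs
sumOver-* k f []       = sym (*-zeroʳ k)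
sumOver-* k f (x ∷ xs) =
  trans (cong (k * f x +_) (sumOver-* k f xs)) (sym (*-distribˡ-+ k (f x) (sumOver f xs)))

sumOver-≥ : {f : A → ℕ} {t : ℕ} {xs : List A} → All (λ x → t ≤ f x) xs → length xs * t ≤ sumOver f xs
sumOver-≥ []           = z≤n
sumOver-≥ (t≤fx ∷ pxs) = +-mono-≤ t≤fx (sumOver-≥ pxs)

degreeIn≤length : {R : A → B → Set} (R? : ∀ x y → Dec (R x y)) (ys : List B) (x : A) →
                  degreeIn R? ys x ≤ length ys
degreeIn≤length R? ys x = length-filter (R? x) ys

other : Colour → Colour
other red  = blue
other blue = red

≡⊎≡other : ∀ c d → d ≡ c ⊎ d ≡ other c
≡⊎≡other red  red  = inj₁ refl
≡⊎≡other red  blue = inj₂ refl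
≡⊎≡other blue red  = inj₂ refl
≡⊎≡other blue blue = inj₁ refl

-- The inequality that `averaging` needs to find `K` vertices of degree at least n/8, scaled by 8 to
-- avoid division. With `d` edges the degree sum is `d + d`, about n²/2 or more, and the 10 absorbs
-- the lower-order terms.
degreeThreshold : ∀ {n K h d} → 8 * K + 10 ≤ n → n * n ≤ 4 * h + n + 2 → h ≤ d →
                  K * (8 * n) + n * n < 8 * (d + d)
degreeThreshold {n} {K} {h} {d} n≥ n²≤ h≤d = +-cancelʳ-< (4 * n + 8) _ _ (begin-strict
  K * (8 * n) + n * n + (4 * n + 8)                 ≤⟨ +-monoʳ-≤ (K * (8 * n) + n * n) (+-monoʳ-≤ (4 * n) 8≤n) ⟩
  K * (8 * n) + n * n + (4 * n + n)                 <⟨ m<m+n _ 0<5n ⟩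
  K * (8 * n) + n * n + (4 * n + n) + 5 * n         ≡⟨ e₁ K n ⟩
  n * (8 * K + 10) + n * n                          ≤⟨ +-monoˡ-≤ (n * n) (*-monoʳ-≤ n n≥) ⟩
  n * n + n * n                                     ≤⟨ m≤m+n _ (2 * (n * n)) ⟩
  n * n + n * n + 2 * (n * n)                       ≡⟨ e₂ (n * n) ⟩
  4 * (n * n)                                       ≤⟨ *-monoʳ-≤ 4 n²≤ ⟩
  4 * (4 * h + n + 2)                               ≤⟨ *-monoʳ-≤ 4 (+-monoˡ-≤ 2 (+-monoˡ-≤ n (*-monoʳ-≤ 4 h≤d))) ⟩
  4 * (4 * d + n + 2)                               ≡⟨ e₃ d n ⟩
  8 * (d + d) + (4 * n + 8)                         ∎)
  where
  open ≤-Reasoning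
  10≤n : 10 ≤ n
  10≤n = ≤-trans (m≤n+m 10 (8 * K)) n≥
  8≤n : 8 ≤ n
  8≤n = ≤-trans (m≤m+n 8 2) 10≤n
  0<5n : 0 < 5 * n
  0<5n = ≤-trans (≤-trans (m≤m+n 1 9) 10≤n) (m≤m+n n _)
  e₁ : ∀ K n → K * (8 * n) + n * n + (4 * n + n) + 5 * n ≡ n * (8 * K + 10) + n * n
  e₁ = solve-∀
  e₂ : ∀ s → s + s + 2 * s ≡ 4 * s
  e₂ = solve-∀
  e₃ : ∀ d n → 4 * (4 * d + n + 2) ≡ 8 * (d + d) + (4 * n + 8)
  e₃ = solve-∀

-- Vertices with few neighbours in a clique of `9 * N` vertices account for at most `8 * N * n` of a
-- total of `9 * N * n`; the remaining `N * n` exceeds `72 * T * N`, the most that `T` vertices can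
-- supply.
bicliqueThreshold : ∀ {n N T} → 0 < N → 72 * T < n → T * (8 * (9 * N)) + n * (8 * N) < 9 * N * n
bicliqueThreshold {n} {N@(suc _)} {T} _ lt = begin-strict
  T * (8 * (9 * N)) + n * (8 * N) ≡⟨ e₁ T n N ⟩
  72 * T * N + n * (8 * N)        <⟨ +-monoˡ-< (n * (8 * N)) (*-monoˡ-< N lt) ⟩
  n * N + n * (8 * N)             ≡⟨ e₂ n N ⟩
  9 * N * n                       ∎
  where
  open ≤-Reasoning
  e₁ : ∀ T n N → T * (8 * (9 * N)) + n * (8 * N) ≡ 72 * T * N + n * (8 * N)
  e₁ = solve-∀
  e₂ : ∀ n N → n * N + n * (8 * N) ≡ 9 * N * n
  e₂ = solve-∀

-- The extra 1 is harmless: if `p` and `q` are both below `m`, then `p + q + 2` is at most `m + m`.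
m+m≤1+p+q : ∀ {m p q} → m + m ≤ suc (p + q) → m ≤ p ⊎ m ≤ q
m+m≤1+p+q {m} {p} {q} le with m ≤? p | m ≤? q
... | yes m≤p | _       = inj₁ m≤p
... | no _    | yes m≤q = inj₂ m≤q
... | no m≰p  | no m≰q  = ⊥-elim (<-irrefl refl (begin-strict
  suc (p + q)     <⟨ n<1+n _ ⟩
  suc (suc (p + q)) ≡⟨ cong suc (+-suc p q) ⟨
  suc p + suc q   ≤⟨ +-mono-≤ (≰⇒> m≰p) (≰⇒> m≰q) ⟩
  m + m           ≤⟨ le ⟩
  suc (p + q)     ∎))
  where open ≤-Reasoning

-- Unavoidable patterns in a colouring

module _ {n : ℕ} (α : Colouring n) where

  -- The condition `u ≢ v` discards the meaningless colours on the diagonal.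
  Edge : Colour → Rel (Fin n) 0ℓ
  Edge c u v = u ≢ v × colour α u v ≡ c

  edge? : ∀ c → Decidable (Edge c)
  edge? c u v = ¬? (u Fin.≟ v) ×-dec (colour α u v ≟ᶜ c)

  edge-sym : ∀ {c} → Symmetric (Edge c)
  edge-sym (u≢v , eq) = u≢v ∘ sym , trans (colour-≡ α _ _) eq

  edge-total : ∀ c {u v} → u ≢ v → Edge c u v ⊎ Edge (other c) u v
  edge-total c u≢v = Sum.map (u≢v ,_) (u≢v ,_) (≡⊎≡other c _)

  degree : Colour → List (Fin n) → Fin n → ℕ
  degree c = degreeIn (edge? c)

  degreeTo : Colour → List (Fin n) → Fin n → ℕ
  degreeTo c = degreeIn (λ v u → edge? c u v)

  -- Since `Edge` is irreflexive, `clique` makes the entries of `xs` distinct and `between` makes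
  -- `xs` and `ys` disjoint.
  record Pattern (N : ℕ) : Set where
    field
      c       : Colour
      xs ys   : List (Fin n)
      N≤∣xs∣  : N ≤ length xs
      N≤∣ys∣  : N ≤ length ys
      clique  : AllPairs (Edge c) xs
      ys!     : Unique ys
      between : ∀ {x y} → x ∈ xs → y ∈ ys → Edge (other c) x y

  degree-sum : ∀ c → let cnt = count α c (completeEdges n) in
               sumOver (degree c (allFin n)) (allFin n) ≡ cnt + cnt
  degree-sum c = trans
    (sym (length-filter-cartesianProduct (edge? c) (allFin n) (allFin n)))
    (handshake (λ u v → ¬? (u Fin.≟ v)) α c (_∘ sym) (λ v≢v → v≢v refl) _
      (Unique.filter⁺ _ (Unique.cartesianProduct⁺ (Unique.allFin⁺ n) (Unique.allFin⁺ n)))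
      (mk⇔ (proj₂ ∘ ∈-filter⁻ _ {xs = cartesianProduct (allFin n) (allFin n)})
           (∈-filter⁺ _ (∈-cartesianProduct⁺ (∈-allFin _) (∈-allFin _)))))

  manyHighDegrees : ∀ c K → 8 * K + 10 ≤ n → (n C 2) / 2 ≤ count α c (completeEdges n) →
                    Among (λ v → n ≤ 8 * degree c (allFin n) v) K (allFin n)
  manyHighDegrees c K n≥ half≤ =
    averaging (λ v → 8 * degree c (allFin n) v) (8 * n) n K (allFin n) bound (begin-strict
      K * (8 * n) + length (allFin n) * n ≡⟨ cong (λ m → K * (8 * n) + m * n) (length-allFin n) ⟩
      K * (8 * n) + n * n                 <⟨ degreeThreshold {K = K} n≥ (n²≤4*half+n+2 n) half≤ ⟩
      8 * (cnt + cnt)                     ≡⟨ cong (8 *_) (degree-sum c) ⟨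
      8 * sumOver (degree c (allFin n)) (allFin n)         ≡⟨ sumOver-* 8 (degree c (allFin n)) (allFin n) ⟨
      sumOver (λ v → 8 * degree c (allFin n) v) (allFin n) ∎)
    where
    open ≤-Reasoning
    cnt = count α c (completeEdges n)
    bound : ∀ v → 8 * degree c (allFin n) v ≤ 8 * n
    bound v = *-monoʳ-≤ 8 (≤-trans (degreeIn≤length (edge? c) (allFin n) v)
                                   (≤-reflexive (length-allFin n)))

  -- `biclique` selects vertices from both lists. Those from `xs` still form a clique, while nothing
  -- is known about colours inside `zs`, so the latter supply the `ys` of the pattern.
  patternFromClique : ∀ c a {xs zs} → AllPairs (Edge c) xs → Unique zs →
    bicliqueBound (suc a) (length xs) ≤ length zs → All (λ z → suc a ≤ degreeTo (other c) xs z) zs → Pattern (suc a)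
  patternFromClique c a {xs} {zs} xs-clique zs! le degs
    with zs′ , xs′ , zs′⊆zs , xs′⊆xs , a≤ , t≤ , r ←
      biclique (λ v u → edge? (other c) u v) a (suc a) xs zs le degs = record
    { c = c ; xs = xs′ ; ys = zs′ ; N≤∣xs∣ = t≤ ; N≤∣ys∣ = a≤
    ; clique  = AllPairs-resp-⊆ xs′⊆xs xs-clique
    ; ys!     = AllPairs-resp-⊆ zs′⊆zs zs!
    ; between = λ x∈ y∈ → All.lookup (All.lookup r y∈) x∈
    }

  -- Counting the edges between `xs` and all vertices from both sides, the average degree into `xs`
  -- is at least `9 * N` eighths; the surplus over `N` forces many vertices to have `N` neighbours
  -- in `xs`.
  manyCommonNeighbours : ∀ c N T {xs} → 0 < N → length xs ≡ 9 * N → 72 * T < n →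
    All (λ v → n ≤ 8 * degree c (allFin n) v) xs → Among (λ v → 8 * N ≤ 8 * degreeTo c xs v) T (allFin n)
  manyCommonNeighbours c N T {xs} 0<N xlen n> high =
    averaging (λ v → 8 * degreeTo c xs v) (8 * (9 * N)) (8 * N) T (allFin n) bound (begin-strict
      T * (8 * (9 * N)) + length (allFin n) * (8 * N)
        ≡⟨ cong (λ m → T * (8 * (9 * N)) + m * (8 * N)) (length-allFin n) ⟩
      T * (8 * (9 * N)) + n * (8 * N)
        <⟨ bicliqueThreshold {T = T} 0<N n> ⟩
      9 * N * n
        ≡⟨ cong (_* n) xlen ⟨
      length xs * n
        ≤⟨ sumOver-≥ high ⟩
      sumOver (λ v → 8 * degree c (allFin n) v) xs
        ≡⟨ sumOver-* 8 (degree c (allFin n)) xs ⟩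
      8 * sumOver (degree c (allFin n)) xs
        ≡⟨ cong (8 *_) (doubleCounting (edge? c) xs (allFin n)) ⟩
      8 * sumOver (degreeTo c xs) (allFin n)
        ≡⟨ sumOver-* 8 (degreeTo c xs) (allFin n) ⟨
      sumOver (λ v → 8 * degreeTo c xs v) (allFin n) ∎)
    where
    open ≤-Reasoning
    bound : ∀ v → 8 * degreeTo c xs v ≤ 8 * (9 * N)
    bound v = *-monoʳ-≤ 8 (≤-trans (degreeIn≤length (λ v u → edge? c u v) xs v) (≤-reflexive xlen))

  -- Ramsey's theorem is applied among the vertices of large degree in colour `other c`, so that a
  -- clique of colour `c` found there is automatically rich in edges of the other colour.
  patternOrClique : ∀ c a M → let N = suc a in
    8 * ramseyBound (9 * N) M + 10 ≤ n → 72 * bicliqueBound N (9 * N) < n →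
    (n C 2) / 2 ≤ count α (other c) (completeEdges n) →
    Pattern N ⊎ Clique (Edge (other c)) M (allFin n)
  patternOrClique c a M n≥ n> half≤ =
    let hs , hs⊆ , len , high = manyHighDegrees (other c) (ramseyBound (9 * suc a) M) n≥ half≤
    in Sum.map (fromRich hs⊆ high) (clique-⊆ hs⊆)
         (ramsey (9 * suc a) M hs (≤-reflexive (sym len))
           (AllPairs.map (edge-total c) (AllPairs-resp-⊆ hs⊆ (Unique.allFin⁺ n))))
    where
    fromRich : ∀ {hs} → hs ⊆ allFin n → All (λ v → n ≤ 8 * degree (other c) (allFin n) v) hs →
              Clique (Edge c) (9 * suc a) hs → Pattern (suc a)
    fromRich hs⊆ high (xs , xs⊆hs , xlen , xs-clique) =
      let zs , zs⊆ , zlen , rich = manyCommonNeighbours (other c) (suc a) (bicliqueBound (suc a) (9 * suc a))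
                                     z<s xlen n> (All-resp-⊆ xs⊆hs high)
      in patternFromClique c a xs-clique (AllPairs-resp-⊆ zs⊆ (Unique.allFin⁺ n))
           (≤-reflexive (trans (cong (bicliqueBound (suc a)) xlen) (sym zlen)))
           (All.map (*-cancelˡ-≤ 8) rich)

  -- The extra 1 is for v itself, which may occur among the xs: Edge is irreflexive.
  degreeTo-total : ∀ v {xs} → Unique xs → length xs ≤ suc (degreeTo blue xs v + degreeTo red xs v)
  degreeTo-total v []         = z≤n
  degreeTo-total v {x ∷ xs} (x≢ ∷ xs!) with x Fin.≟ v
  ... | yes refl = s≤s (distinct xs x≢)
    where
    distinct : ∀ xs → All (v ≢_) xs → length xs ≤ degreeTo blue xs v + degreeTo red xs v
    distinct []       []          = z≤n
    distinct (x ∷ xs) (v≢x ∷ v≢) with x Fin.≟ v | colour α x v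
    ... | yes x≡v | _    = ⊥-elim (v≢x (sym x≡v))
    ... | no _    | red  = ≤-trans (s≤s (distinct xs v≢)) (≤-reflexive (sym (+-suc _ _)))
    ... | no _    | blue = s≤s (distinct xs v≢)
  ... | no _ with colour α x v
  ...   | red  = s≤s (≤-trans (degreeTo-total v xs!) (≤-reflexive (sym (+-suc _ _))))
  ...   | blue = s≤s (degreeTo-total v xs!)

  clique⇒Unique : ∀ {c xs} → AllPairs (Edge c) xs → Unique xs
  clique⇒Unique = AllPairs.map proj₁

  -- Each vertex of the blue clique sends at least `N` edges of one colour into the red clique, and
  -- half of these vertices agree on the colour. The two cliques may share a vertex.
  twoCliques : ∀ a → let N = suc a; M = bicliqueBound N (N + N) in
    Clique (Edge red) (N + N) (allFin n) → Clique (Edge blue) (M + M) (allFin n) → Pattern N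
  twoCliques a (ps , _ , plen , ps-clique) (qs , _ , qlen , qs-clique)
    with pigeonhole (bicliqueBound (suc a) (suc a + suc a)) _ qs (≤-reflexive (sym qlen)) (All.universal
           (λ q → m+m≤1+p+q (≤-trans (≤-reflexive (sym plen)) (degreeTo-total q (clique⇒Unique ps-clique)))) qs)
  ... | inj₁ (zs , zs⊆qs , zlen , degs) =
    patternFromClique red a ps-clique (AllPairs-resp-⊆ zs⊆qs (clique⇒Unique qs-clique))
      (≤-reflexive (trans (cong (bicliqueBound (suc a)) plen) (sym zlen))) degs
  -- With red edges in between, the roles are exchanged: the blue clique provides `xs` and the red
  -- one `ys`.
  ... | inj₂ (zs , zs⊆qs , zlen , degs)
    with zs′ , ps′ , zs′⊆zs , ps′⊆ps , a≤ , t≤ , r ←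
      biclique (λ v u → edge? red u v) a (suc a) ps zs
        (≤-reflexive (trans (cong (bicliqueBound (suc a)) plen) (sym zlen))) degs = record
    { c = blue ; xs = zs′ ; ys = ps′ ; N≤∣xs∣ = a≤ ; N≤∣ys∣ = t≤
    ; clique  = AllPairs-resp-⊆ (⊆-trans zs′⊆zs zs⊆qs) qs-clique
    ; ys!     = AllPairs-resp-⊆ ps′⊆ps (clique⇒Unique ps-clique)
    ; between = λ x∈ y∈ → edge-sym (All.lookup (All.lookup r x∈) y∈)
    }

-- Combining the lower bounds on n

Eventually : (ℕ → Set) → Set
Eventually P = ∃[ n₀ ] ∀ n → n ≥ n₀ → P n

eventually-zipWith : {P Q S : ℕ → Set} → (∀ {n} → P n → Q n → S n) →
                     Eventually P → Eventually Q → Eventually S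
eventually-zipWith f (n₁ , p) (n₂ , q) =
  n₁ + n₂ , λ n n≥ → f (p n (m+n≤o⇒m≤o n₁ n≥)) (q n (m+n≤o⇒n≤o n₁ n≥))

eventuallyPatternOrClique : ∀ c a M → Eventually λ n → (α : Colouring n) →
  (n C 2) / 2 ≤ count α (other c) (completeEdges n) →
  Pattern α (suc a) ⊎ Clique (Edge α (other c)) M (allFin n)
eventuallyPatternOrClique c a M =
  -- Each hypothesis on `n` holds eventually with its own bound as threshold; unification fills in
  -- the bounds.
  eventually-zipWith (λ n≥ n> α → patternOrClique α c a M n≥ n>) (_ , λ _ n≥ → n≥) (_ , λ _ n> → n>)

unavoidablePattern : ∀ a → Eventually λ n → (α : Colouring n) →
  (∀ c → (n C 2) / 2 ≤ count α c (completeEdges n)) → Pattern α (suc a)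
unavoidablePattern a = eventually-zipWith
  (λ p q α half≤ → merge α (p α (half≤ red)) (q α (half≤ blue)))
  (eventuallyPatternOrClique blue a (N + N)) (eventuallyPatternOrClique red a (M + M))
  where
  N = suc a
  M = bicliqueBound N (N + N)
  merge : ∀ {n} (α : Colouring n) →
          Pattern α N ⊎ Clique (Edge α red) (N + N) (allFin n) →
          Pattern α N ⊎ Clique (Edge α blue) (M + M) (allFin n) → Pattern α N
  merge α (inj₁ p)  _         = p
  merge α (inj₂ _)  (inj₁ p)  = p
  merge α (inj₂ rs) (inj₂ bs) = twoCliques α a rs bs

-- The copy of a graph given by an injective vertex map

comprehension : ∀ {n} {P : Pred (Fin n) 0ℓ} → (∀ u → Dec (P u)) → Subset.Subset n
comprehension P? = tabulate (does ∘ P?)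

∈-comprehension⁺ : ∀ {n} {P : Pred (Fin n) 0ℓ} (P? : ∀ u → Dec (P u)) {u} → P u → u Subset.∈ comprehension P?
∈-comprehension⁺ P? {u} pu =
  lookup⇒[]= u _ (trans (lookup∘tabulate (does ∘ P?) u) (dec-true (P? u) pu))

∈-comprehension⁻ : ∀ {n} {P : Pred (Fin n) 0ℓ} (P? : ∀ u → Dec (P u)) {u} → u Subset.∈ comprehension P? → P u
∈-comprehension⁻ P? {u} u∈ with P? u | trans (sym (lookup∘tabulate (does ∘ P?) u)) ([]=⇒lookup u∈)
... | yes pu | _ = pu

module _ {n : ℕ} (α : Colouring n) {V : Set} (G : Graph V) (adj? : Decidable (Adj G))
         (vs : List V) (vs! : Unique vs) (∈vs : ∀ v → v ∈ vs)
         (φ : V → Fin n) (φ-injective : ∀ {u v} → φ u ≡ φ v → u ≡ v) where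

  private
    φ² : V × V → Fin n × Fin n
    φ² (u , v) = φ u , φ v

    arcs : List (V × V)
    arcs = filter (uncurry adj?) (cartesianProduct vs vs)

    arcs! : Unique arcs
    arcs! = Unique.filter⁺ _ (Unique.cartesianProduct⁺ vs! vs!)

    ∈arcs⁺ : ∀ {u v} → Adj G u v → (u , v) ∈ arcs
    ∈arcs⁺ = ∈-filter⁺ _ (∈-cartesianProduct⁺ (∈vs _) (∈vs _))

    ∈arcs⁻ : ∀ {u v} → (u , v) ∈ arcs → Adj G u v
    ∈arcs⁻ = proj₂ ∘ ∈-filter⁻ _ {xs = cartesianProduct vs vs}

    φ²-injective : ∀ {p q} → φ² p ≡ φ² q → p ≡ q
    φ²-injective eq = cong₂ _,_ (φ-injective (cong proj₁ eq)) (φ-injective (cong proj₂ eq))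

    image? : ∀ u → Dec (u ∈ map φ vs)
    image? u = DecMembership._∈?_ Fin._≟_ u (map φ vs)

    image-symm : ∀ {u v} → (u , v) ∈ map φ² arcs → (v , u) ∈ map φ² arcs
    image-symm uv∈ with _ , ab∈ , refl ← ∈-map⁻ φ² uv∈ = ∈-map⁺ φ² (∈arcs⁺ (symm G (∈arcs⁻ ab∈)))

    image-irrefl : ∀ {u v} → (u , v) ∈ map φ² arcs → u ≢ v
    image-irrefl uv∈ u≡v with _ , ab∈ , refl ← ∈-map⁻ φ² uv∈ with refl ← φ-injective u≡v =
      noLoop G (∈arcs⁻ ab∈)

  -- Adjacency is membership in the list of image arcs, which makes it decidable.
  copy : Subgraph (complete n)
  copy = record
    { verts = comprehension image?
    ; SAdj  = λ u v → (u , v) ∈ map φ² arcs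
    ; sadj? = λ u v → DecMembership._∈?_ (≡-dec Fin._≟_ Fin._≟_) (u , v) (map φ² arcs)
    ; ssymm = image-symm
    ; sub   = image-irrefl
    ; ends  = λ uv∈ → let _ , _ , eq = ∈-map⁻ φ² uv∈ in
        ∈-comprehension⁺ image? (subst (_∈ map φ vs) (sym (cong proj₁ eq)) (∈-map⁺ φ (∈vs _)))
    }

  copy≅G : Subgraph.graph copy ≅ G
  copy≅G = record
    { vertices = mk↔ₛ′ to from
        (λ v → φ-injective (φ-to (from v)))
        -- A vertex of the copy carries a membership proof, and any two such proofs are equal.
        (λ u → Σ-≡,≡→≡ (φ-to u , []=-irrelevant _ _))
    ; adjacent = λ u v → mk⇔
        (λ uv∈ → let _ , ab∈ , eq = ∈-map⁻ φ² uv∈ in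
           subst₂ (Adj G) (φ-injective (trans (sym (cong proj₁ eq)) (sym (φ-to u))))
                          (φ-injective (trans (sym (cong proj₂ eq)) (sym (φ-to v)))) (∈arcs⁻ ab∈))
        (λ adj → subst₂ (λ u v → (u , v) ∈ map φ² arcs) (φ-to u) (φ-to v) (∈-map⁺ φ² (∈arcs⁺ adj)))
    }
    where
    preimage : ∀ {u} → u Subset.∈ Subgraph.verts copy → ∃[ v ] v ∈ vs × u ≡ φ v
    preimage = ∈-map⁻ φ ∘ ∈-comprehension⁻ image?
    to : ∃ (Subset._∈ Subgraph.verts copy) → V
    to (_ , u∈) = proj₁ (preimage u∈)
    φ-to : ∀ u → φ (to u) ≡ proj₁ u
    φ-to (_ , u∈) = sym (proj₂ (proj₂ (preimage u∈)))
    from : V → ∃ (Subset._∈ Subgraph.verts copy)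
    from v = φ v , ∈-comprehension⁺ image? (∈-map⁺ φ (∈vs v))

  -- Balance from a colour-reversing involution

  module _ (ρ : V → V) (ρ-involutive : ∀ v → ρ (ρ v) ≡ v)
           (ρ-adj : ∀ {u v} → Adj G u v → Adj G (ρ u) (ρ v))
           (ρ-colour : ∀ {u v} → Adj G u v →
                       colour α (φ (ρ u)) (φ (ρ v)) ≡ other (colour α (φ u) (φ v))) where

    private
      arcsOf : Colour → List (V × V)
      arcsOf c = filter (λ (u , v) → colour α (φ u) (φ v) ≟ᶜ c) arcs

      arcsOf! : ∀ c → Unique (arcsOf c)
      arcsOf! c = Unique.filter⁺ _ arcs!

      ∈arcsOf⁺ : ∀ {c u v} → Adj G u v → colour α (φ u) (φ v) ≡ c → (u , v) ∈ arcsOf c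
      ∈arcsOf⁺ adj = ∈-filter⁺ _ (∈arcs⁺ adj)

      ∈arcsOf⁻ : ∀ {c u v} → (u , v) ∈ arcsOf c → Adj G u v × colour α (φ u) (φ v) ≡ c
      ∈arcsOf⁻ uv∈ with uv∈arcs , col ← ∈-filter⁻ _ {xs = arcs} uv∈ = ∈arcs⁻ uv∈arcs , col

      copyCount : ∀ c → let cnt = count α c (edges (Subgraph.sadj? copy)) in length (arcsOf c) ≡ cnt + cnt
      copyCount c = trans (sym (length-map φ² (arcsOf c)))
        (handshake (Subgraph.sadj? copy) α c image-symm (λ vv∈ → image-irrefl vv∈ refl)
          (map φ² (arcsOf c)) (Unique.map⁺ φ²-injective (arcsOf! c)) (mk⇔ to from))
        where
        to : ∀ {u v} → (u , v) ∈ map φ² (arcsOf c) → (u , v) ∈ map φ² arcs × colour α u v ≡ c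
        to uv∈ with _ , ab∈ , refl ← ∈-map⁻ φ² uv∈ with ab∈arcs , col ← ∈-filter⁻ _ {xs = arcs} ab∈ =
          ∈-map⁺ φ² ab∈arcs , col
        from : ∀ {u v} → (u , v) ∈ map φ² arcs × colour α u v ≡ c → (u , v) ∈ map φ² (arcsOf c)
        from (uv∈ , col) with _ , ab∈ , refl ← ∈-map⁻ φ² uv∈ = ∈-map⁺ φ² (∈-filter⁺ _ ab∈ col)

      ρ² : V × V → V × V
      ρ² (u , v) = ρ u , ρ v

      ρ²-involutive : ∀ p → ρ² (ρ² p) ≡ p
      ρ²-involutive (u , v) = cong₂ _,_ (ρ-involutive u) (ρ-involutive v)

      ∈arcsOf-ρ : ∀ {c u v} → (u , v) ∈ arcsOf c → (ρ u , ρ v) ∈ arcsOf (other c)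
      ∈arcsOf-ρ uv∈ = let adj , col = ∈arcsOf⁻ uv∈ in
        ∈arcsOf⁺ (ρ-adj adj) (trans (ρ-colour adj) (cong other col))

      -- `ρ²` is injective and maps red arcs to blue ones; as an involution that also maps blue arcs
      -- to red ones, it is onto.
      red≡blue : length (arcsOf red) ≡ length (arcsOf blue)
      red≡blue = trans (sym (length-map ρ² (arcsOf red)))
        (unique-length (Unique.map⁺ ρ²-injective (arcsOf! red)) (arcsOf! blue) (mk⇔ to from))
        where
        ρ²-injective : ∀ {p q} → ρ² p ≡ ρ² q → p ≡ q
        ρ²-injective {p} {q} eq = trans (sym (ρ²-involutive p)) (trans (cong ρ² eq) (ρ²-involutive q))
        to : ∀ {p} → p ∈ map ρ² (arcsOf red) → p ∈ arcsOf blue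
        to p∈ with _ , q∈ , refl ← ∈-map⁻ ρ² p∈ = ∈arcsOf-ρ q∈
        from : ∀ {p} → p ∈ arcsOf blue → p ∈ map ρ² (arcsOf red)
        from {p} p∈ = subst (_∈ map ρ² (arcsOf red)) (ρ²-involutive p) (∈-map⁺ ρ² (∈arcsOf-ρ p∈))

    containsBalanced : ContainsBalanced α G
    containsBalanced = copy , copy≅G , ≤-trans (≤-reflexive (m≡n⇒∣m-n∣≡0 counts≡)) z≤n
      where
      m+m≡k+k⇒m≡k : ∀ m k → m + m ≡ k + k → m ≡ k
      m+m≡k+k⇒m≡k m k eq = *-cancelˡ-≡ m k 2
        (trans (cong (m +_) (+-identityʳ m)) (trans eq (cong (k +_) (sym (+-identityʳ k)))))
      cnt : Colour → ℕ
      cnt c = count α c (edges (Subgraph.sadj? copy))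
      counts≡ = m+m≡k+k⇒m≡k (cnt red) (cnt blue) (trans (sym (copyCount red)) (trans red≡blue (copyCount blue)))

-- The half-turn of the grid and its parity classes

opposite-+ : ∀ {n} (i : Fin n) → toℕ (opposite i) + suc (toℕ i) ≡ n
opposite-+ {n} i = trans (cong (_+ suc (toℕ i)) (Fin.opposite-prop i)) (m∸n+n≡m (Fin.toℕ<n i))

opposite-suc : ∀ {n} {i j : Fin n} → suc (toℕ i) ≡ toℕ j → suc (toℕ (opposite j)) ≡ toℕ (opposite i)
opposite-suc {n} {i} {j} i+1≡j = +-cancelʳ-≡ (suc (toℕ i)) _ _ (begin
  suc (toℕ (opposite j)) + suc (toℕ i)  ≡⟨ +-suc (toℕ (opposite j)) (suc (toℕ i)) ⟨
  toℕ (opposite j) + suc (suc (toℕ i))  ≡⟨ cong (λ m → toℕ (opposite j) + suc m) i+1≡j ⟩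
  toℕ (opposite j) + suc (toℕ j)        ≡⟨ opposite-+ j ⟩
  n                                     ≡⟨ opposite-+ i ⟨
  toℕ (opposite i) + suc (toℕ i)        ∎)
  where open ≡-Reasoning

path-opposite : ∀ {n} {i j : Fin n} → Adj (path n) i j → Adj (path n) (opposite i) (opposite j)
path-opposite (inj₁ p) = inj₂ (opposite-suc p)
path-opposite (inj₂ p) = inj₁ (opposite-suc p)

parity-suc : ∀ m → parity (suc m) ≡ parity m ⁻¹
parity-suc m = trans (sym (ℙ.⁻¹-involutive _)) (cong _⁻¹ (ℙ.suc-homo-⁻¹ m))

path-parity : ∀ {n} {i j : Fin n} → Adj (path n) i j → parity (toℕ j) ≡ parity (toℕ i) ⁻¹
path-parity {i = i} {j} (inj₁ p) = trans (cong parity (sym p)) (parity-suc (toℕ i))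
path-parity {i = i} {j} (inj₂ p) = trans (sym (ℙ.suc-homo-⁻¹ (toℕ j))) (cong (λ m → parity m ⁻¹) p)

path-adj? : ∀ n → Decidable (Adj (path n))
path-adj? n i j = (suc (toℕ i) ≟ toℕ j) ⊎-dec (suc (toℕ j) ≟ toℕ i)

-- A fixed point `i` forces n = 2i + 1.
opposite-fixed : ∀ {n} {i : Fin n} → opposite i ≡ i → ⌊ n /2⌋ ≡ toℕ i
opposite-fixed {n} {i} eq = begin
  ⌊ n /2⌋                              ≡⟨ cong ⌊_/2⌋ (opposite-+ i) ⟨
  ⌊ toℕ (opposite i) + suc (toℕ i) /2⌋ ≡⟨ cong (λ j → ⌊ toℕ j + suc (toℕ i) /2⌋) eq ⟩
  -- By definition `⌈ m /2⌉` is `⌊ suc m /2⌋`.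
  ⌊ toℕ i + suc (toℕ i) /2⌋            ≡⟨ cong ⌊_/2⌋ (+-suc (toℕ i) (toℕ i)) ⟩
  ⌈ toℕ i + toℕ i /2⌉                  ≡⟨ n≡⌈n+n/2⌉ (toℕ i) ⟨
  toℕ i                                ∎
  where open ≡-Reasoning

opposite-parity : ∀ {n} (i : Fin n) → parity (toℕ (opposite i)) ≡ parity n ℙ.+ parity (toℕ i) ⁻¹
opposite-parity {n} i = trans (cancel _ (parity (toℕ i))) (cong (ℙ._+ parity (toℕ i) ⁻¹) (begin
  parity (toℕ (opposite i)) ℙ.+ parity (toℕ i) ⁻¹     ≡⟨ cong (parity (toℕ (opposite i)) ℙ.+_) (parity-suc (toℕ i)) ⟨
  parity (toℕ (opposite i)) ℙ.+ parity (suc (toℕ i))  ≡⟨ ℙ.+-homo-+ (toℕ (opposite i)) (suc (toℕ i)) ⟨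
  parity (toℕ (opposite i) + suc (toℕ i))             ≡⟨ cong parity (opposite-+ i) ⟩
  parity n                                            ∎))
  where
  open ≡-Reasoning
  cancel : ∀ p a → p ≡ (p ℙ.+ a ⁻¹) ℙ.+ a ⁻¹
  cancel 0ℙ 0ℙ = refl
  cancel 0ℙ 1ℙ = refl
  cancel 1ℙ 0ℙ = refl
  cancel 1ℙ 1ℙ = refl

module Rotation (k ℓ : ℕ) where

  private
    V = Fin k × Fin ℓ

  grid-adj? : Decidable (Adj (grid k ℓ))
  grid-adj? (i , j) (i′ , j′) =
    ((i Fin.≟ i′) ×-dec path-adj? ℓ j j′) ⊎-dec ((j Fin.≟ j′) ×-dec path-adj? k i i′)

  -- This numbering both orders the two vertices of an orbit and assigns vertices to positions in a
  -- pattern.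
  index : V → Fin (k * ℓ)
  index (i , j) = combine i j

  index-injective : ∀ {u v} → index u ≡ index v → u ≡ v
  index-injective {i , j} {i′ , j′} eq = uncurry (cong₂ _,_) (Fin.combine-injective i j i′ j′ eq)

  rotate : V → V
  rotate (i , j) = opposite i , opposite j

  rotate-involutive : ∀ v → rotate (rotate v) ≡ v
  rotate-involutive (i , j) = cong₂ _,_ (Fin.opposite-involutive i) (Fin.opposite-involutive j)

  rotate-adj : ∀ {u v} → Adj (grid k ℓ) u v → Adj (grid k ℓ) (rotate u) (rotate v)
  rotate-adj (inj₁ (refl , adj)) = inj₁ (refl , path-opposite adj)
  rotate-adj (inj₂ (refl , adj)) = inj₂ (refl , path-opposite adj)

  gridParity : V → Parity
  gridParity (i , j) = parity (toℕ i) ℙ.+ parity (toℕ j)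

  gridParity-adj : ∀ u v → Adj (grid k ℓ) u v → gridParity v ≡ gridParity u ⁻¹
  gridParity-adj (i , j) _ (inj₁ (refl , adj)) rewrite path-parity adj = +-⁻¹ʳ (parity (toℕ i)) (parity (toℕ j))
    where
    +-⁻¹ʳ : ∀ p q → p ℙ.+ q ⁻¹ ≡ (p ℙ.+ q) ⁻¹
    +-⁻¹ʳ 0ℙ q = refl
    +-⁻¹ʳ 1ℙ q = refl
  gridParity-adj (i , j) _ (inj₂ (refl , adj)) rewrite path-parity adj = +-⁻¹ˡ (parity (toℕ i)) (parity (toℕ j))
    where
    +-⁻¹ˡ : ∀ p q → p ⁻¹ ℙ.+ q ≡ (p ℙ.+ q) ⁻¹
    +-⁻¹ˡ 0ℙ q = refl
    +-⁻¹ˡ 1ℙ q = sym (ℙ.⁻¹-involutive q)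

  -- For odd k and ℓ the centre of the grid is fixed by the rotation: this is the
  -- parity class which avoids it.
  class : Parity
  class = (parity ⌊ k /2⌋ ℙ.+ parity ⌊ ℓ /2⌋) ⁻¹

  -- A fixed vertex has coordinates `⌊ k /2⌋` and `⌊ ℓ /2⌋`, so its parity is the one opposite to
  -- `class`.
  class-unfixed : ∀ v → gridParity v ≡ class → rotate v ≢ v
  class-unfixed v@(i , j) v∈ fixed = ℙ.p≢p⁻¹ (gridParity v) (trans v∈ (cong _⁻¹
    (cong₂ (λ a b → parity a ℙ.+ parity b) (opposite-fixed (cong proj₁ fixed)) (opposite-fixed (cong proj₂ fixed)))))

  -- The half-turn shifts the parity of a vertex by `parity k ℙ.+ parity ℓ`; this is where equal
  -- parity of `k` and `ℓ` enters.
  rotate-parity : parity k ≡ parity ℓ → ∀ v → gridParity (rotate v) ≡ gridParity v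
  rotate-parity k≡ℓ (i , j)
    rewrite opposite-parity i | opposite-parity j | k≡ℓ = cancel (parity ℓ) (parity (toℕ i)) (parity (toℕ j))
    where
    cancel : ∀ p a b → (p ℙ.+ a ⁻¹) ℙ.+ (p ℙ.+ b ⁻¹) ≡ a ℙ.+ b
    cancel 0ℙ 0ℙ 0ℙ = refl
    cancel 0ℙ 0ℙ 1ℙ = refl
    cancel 0ℙ 1ℙ 0ℙ = refl
    cancel 0ℙ 1ℙ 1ℙ = refl
    cancel 1ℙ 0ℙ 0ℙ = refl
    cancel 1ℙ 0ℙ 1ℙ = refl
    cancel 1ℙ 1ℙ 0ℙ = refl
    cancel 1ℙ 1ℙ 1ℙ = refl

  -- Selects one vertex from each orbit of size two; a fixed vertex is never selected.
  First : V → Set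
  First v = index v Fin.< index (rotate v)

  first? : ∀ v → Dec (First v)
  first? v = index v Fin.<? index (rotate v)

  first-rotate : ∀ v → First v → ¬ First (rotate v)
  first-rotate v v< rv< =
    Fin.<-asym v< (subst (λ w → index (rotate v) Fin.< index w) (rotate-involutive v) rv<)

  rotate-first : ∀ v → rotate v ≢ v → ¬ First v → First (rotate v)
  rotate-first v unfixed v≮ with Fin.<-cmp (index v) (index (rotate v))
  ... | tri< v< _ _ = ⊥-elim (v≮ v<)
  ... | tri≈ _ eq _ = ⊥-elim (unfixed (sym (index-injective eq)))
  ... | tri> _ _ v> = subst (λ w → index (rotate v) Fin.< index w) (sym (rotate-involutive v)) v>

  -- The independent set `I`.
  Chosen : V → Set
  Chosen v = gridParity v ≡ class × First v

  chosen? : ∀ v → Dec (Chosen v)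
  chosen? v = (gridParity v ℙ.≟ class) ×-dec first? v

-- Placing the grid into a pattern

allPairs-lookup : {A : Set} {R : Rel A 0ℓ} → Symmetric R → {xs : List A} → AllPairs R xs →
                  ∀ {i j} → i ≢ j → R (lookup xs i) (lookup xs j)
allPairs-lookup R-sym (px ∷ pxs) {Fin.zero}  {Fin.zero}  i≢j = ⊥-elim (i≢j refl)
allPairs-lookup R-sym (px ∷ pxs) {Fin.zero}  {Fin.suc j} i≢j = All.lookup px (∈-lookup j)
allPairs-lookup R-sym (px ∷ pxs) {Fin.suc i} {Fin.zero}  i≢j = R-sym (All.lookup px (∈-lookup i))
allPairs-lookup R-sym (px ∷ pxs) {Fin.suc i} {Fin.suc j} i≢j = allPairs-lookup R-sym pxs (i≢j ∘ cong Fin.suc)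

other-involutive : ∀ c → other (other c) ≡ c
other-involutive red  = refl
other-involutive blue = refl

module _ {n k ℓ : ℕ} (α : Colouring n) (k≡ℓ : parity k ≡ parity ℓ) (P : Pattern α (suc (k * ℓ))) where
  open Pattern P
  open Rotation k ℓ

  private
    x y : Fin (k * ℓ) → Fin n
    -- The pattern has size one more than the number of grid vertices, which keeps its size
    -- positive; `<⇒≤` discards the surplus.
    x i = lookup xs (inject≤ i (<⇒≤ N≤∣xs∣))
    y i = lookup ys (inject≤ i (<⇒≤ N≤∣ys∣))

    x-edge : ∀ {i j} → i ≢ j → Edge α c (x i) (x j)
    x-edge i≢j = allPairs-lookup (edge-sym α) clique (i≢j ∘ Fin.inject≤-injective _ _ _ _)

    y-distinct : ∀ {i j} → i ≢ j → y i ≢ y j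
    y-distinct i≢j = allPairs-lookup (_∘ sym) ys! (i≢j ∘ Fin.inject≤-injective _ _ _ _)

    xy-edge : ∀ i j → Edge α (other c) (x i) (y j)
    xy-edge i j = between (∈-lookup _) (∈-lookup _)

    -- The decision is an argument, so that injectivity follows by matching on two arbitrary
    -- decisions.
    place : {Q : Set} → Dec Q → Fin (k * ℓ) → Fin n
    place (yes _) = y
    place (no _)  = x

    place-injective : ∀ {Q Q′ : Set} (d : Dec Q) (d′ : Dec Q′) {i j} → place d i ≡ place d′ j → i ≡ j
    place-injective d d′ {i} {j} eq with i Fin.≟ j
    ... | yes i≡j = i≡j
    place-injective (yes _) (yes _) eq | no i≢j = ⊥-elim (y-distinct i≢j eq)
    -- The two sides of the pattern are disjoint, because `Edge` requires distinct ends.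
    place-injective (yes _) (no _)  {i} {j} eq | no i≢j = ⊥-elim (proj₁ (xy-edge j i) (sym eq))
    place-injective (no _)  (yes _) {i} {j} eq | no i≢j = ⊥-elim (proj₁ (xy-edge i j) eq)
    place-injective (no _)  (no _)  eq | no i≢j = ⊥-elim (proj₁ (x-edge i≢j) eq)

    φ : Fin k × Fin ℓ → Fin n
    φ v = place (chosen? v) (index v)

    adj⇒≢ : ∀ u v → Adj (grid k ℓ) u v → index u ≢ index v
    adj⇒≢ u v adj eq = noLoop (grid k ℓ) (subst (Adj (grid k ℓ) u) (sym (index-injective eq)) adj)

    colour-chosen : ∀ u v → Chosen u → ¬ Chosen v → colour α (φ u) (φ v) ≡ other c
    colour-chosen u v u∈ v∉ with chosen? u | chosen? v
    ... | no u∉ | _      = ⊥-elim (u∉ u∈)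
    ... | yes _ | yes v∈ = ⊥-elim (v∉ v∈)
    ... | yes _ | no _   = proj₂ (edge-sym α (xy-edge _ _))

    colour-unchosen : ∀ u v → Adj (grid k ℓ) u v → ¬ Chosen u → ¬ Chosen v → colour α (φ u) (φ v) ≡ c
    colour-unchosen u v adj u∉ v∉ with chosen? u | chosen? v
    ... | yes u∈ | _      = ⊥-elim (u∉ u∈)
    ... | no _   | yes v∈ = ⊥-elim (v∉ v∈)
    ... | no _   | no _   = proj₂ (x-edge (adj⇒≢ u v adj))

    neighbour-unchosen : ∀ u v → gridParity u ≡ class → Adj (grid k ℓ) u v → ¬ Chosen v
    neighbour-unchosen u v u∈ adj (v∈ , _) =
      ℙ.p≢p⁻¹ class (trans (sym v∈) (trans (gridParity-adj u v adj) (cong _⁻¹ u∈)))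

    -- As `u` is the only end in `class`, the edge has colour `other c` exactly when `u` is `First`.
    -- The half-turn keeps `u` in the class and exchanges the two vertices of its orbit, only one of
    -- which is `First`.
    rotate-colour-class : ∀ u v → gridParity u ≡ class → Adj (grid k ℓ) u v → Dec (First u) →
                          colour α (φ (rotate u)) (φ (rotate v)) ≡ other (colour α (φ u) (φ v))
    rotate-colour-class u v u∈ adj = λ
      { (yes u<) → trans
        (colour-unchosen (rotate u) (rotate v) (rotate-adj adj) (first-rotate u u< ∘ proj₂) rv∉)
        (sym (trans (cong other (colour-chosen u v (u∈ , u<) v∉)) (other-involutive c)))
      ; (no u≮) → trans
        (colour-chosen (rotate u) (rotate v) (ru∈ , rotate-first u (class-unfixed u u∈) u≮) rv∉)
        (sym (cong other (colour-unchosen u v adj (u≮ ∘ proj₂) v∉)))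
      }
      where
      ru∈ = trans (rotate-parity k≡ℓ u) u∈
      v∉  = neighbour-unchosen u v u∈ adj
      rv∉ = neighbour-unchosen (rotate u) (rotate v) ru∈ (rotate-adj adj)

    ≡⊎≡⁻¹ : ∀ p q → q ≡ p ⊎ q ⁻¹ ≡ p
    ≡⊎≡⁻¹ 0ℙ 0ℙ = inj₁ refl
    ≡⊎≡⁻¹ 0ℙ 1ℙ = inj₂ refl
    ≡⊎≡⁻¹ 1ℙ 0ℙ = inj₂ refl
    ≡⊎≡⁻¹ 1ℙ 1ℙ = inj₁ refl

    rotate-colour : ∀ {u v} → Adj (grid k ℓ) u v →
                    colour α (φ (rotate u)) (φ (rotate v)) ≡ other (colour α (φ u) (φ v))
    rotate-colour {u} {v} adj with ≡⊎≡⁻¹ class (gridParity u)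
    ... | inj₁ u∈ = rotate-colour-class u v u∈ adj (first? u)
    -- Here `v` is the end in `class`, so the edge is read backwards.
    ... | inj₂ v∈ = trans (colour-≡ α _ _) (trans
      (rotate-colour-class v u (trans (gridParity-adj u v adj) v∈) (symm (grid k ℓ) {u} {v} adj) (first? v))
      (cong other (colour-≡ α _ _)))

  balancedGrid : ContainsBalanced α (grid k ℓ)
  balancedGrid = containsBalanced α (grid k ℓ) grid-adj? (cartesianProduct (allFin k) (allFin ℓ))
    (Unique.cartesianProduct⁺ (Unique.allFin⁺ k) (Unique.allFin⁺ ℓ))
    (λ _ → ∈-cartesianProduct⁺ (∈-allFin _) (∈-allFin _))
    φ (λ {u} {v} eq → index-injective (place-injective (chosen? u) (chosen? v) eq))
    rotate rotate-involutive rotate-adj rotate-colour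

-- Choice of m and conclusion

-- Positivity leaves room for an `m` strictly below half of the edges. Otherwise n² would be at most
-- n + 2, impossible from 3 on.
half-positive : ∀ n → 3 ≤ n → 0 < (n C 2) / 2
half-positive n 3≤n = positive ((n C 2) / 2) (n²≤4*half+n+2 n)
  where
  open ≤-Reasoning
  positive : ∀ h → n * n ≤ 4 * h + n + 2 → 0 < h
  positive (suc h) _   = z<s
  positive zero    n²≤ = ⊥-elim (<-irrefl refl (begin-strict
    n + 2       <⟨ +-monoʳ-< n 3≤n ⟩
    n + n       ≤⟨ +-monoʳ-≤ n (m≤m+n n (n + 0)) ⟩
    3 * n       ≤⟨ *-monoˡ-≤ n 3≤n ⟩
    n * n       ≤⟨ n²≤ ⟩
    n + 2       ∎))

theorem20 : (k ℓ : ℕ) → k > 1 → ℓ > 1 → parity k ≡ parity ℓ → Balanceable (grid k ℓ)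
theorem20 k ℓ _ _ k≡ℓ =
  let n₁ , pattern-from-n₁ = unavoidablePattern (k * ℓ)
  in n₁ + 3 , λ n n≥ →
    let 0<half = half-positive n (m+n≤o⇒n≤o n₁ n≥)
    -- With `m` one below half of the edges, more than `m` edges of a colour means at least half.
    in pred ((n C 2) / 2) , pred< _ 0<half , λ α red> blue> →
      balancedGrid α k≡ℓ (pattern-from-n₁ n (m+n≤o⇒m≤o n₁ n≥) α
        λ { red  → ≤-trans (suc-pred-≤ _) red>
          ; blue → ≤-trans (suc-pred-≤ _) blue> })
  where
  pred< : ∀ h → 0 < h → pred h < h
  pred< (suc h) _ = n<1+n h
  suc-pred-≤ : ∀ h → h ≤ suc (pred h)
  suc-pred-≤ zero    = z≤n
  suc-pred-≤ (suc h) = ≤-refl
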